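{- Let $\Lambda$ be an extended metric space with a monoid structure $(\Lambda,*,0)$ such that $d_\Lambda(\alpha*\beta,\alpha'*\beta')\le d_\Lambda(\alpha,\alpha')+d_\Lambda(\beta,\beta')$ for all $\alpha,\alpha',\beta,\beta'\in\Lambda$, and let $\mathcal{W}$ be the quantitative theory of writing computations of type $\Lambda$. The monads $T_{\mathcal{W}}$ and $(\Lambda\,\square\,-)$ on $\mathbf{Met}$ are isomorphic.
   Context: An extended metric space is a set $X$ with $d_X:X\times X\to[0,\infty]$ satisfying $d_X(x,y)=0$ iff $x=y$, symmetry and the triangle inequality. $\mathbf{Met}$ is the category of extended metric spaces and non-expansive maps. Quantitative theories. A signature $\Sigma$ is a set of function symbols $f:n$ of finite arity $n\in\mathbb{N}$. Fix a countably infinite set of variables $V$; terms are $\Sigma$-terms over $V$. A quantitative equation is an expression $t=_\varepsilon s$ with $t,s$ terms and $\varepsilon\in\mathbb{Q}_{\ge0}$. A conditional quantitative equation is $\Gamma\vdash t=_\varepsilon s$ with $\Gamma$ a finite set of quantitative equations. A quantitative equational theory of type $\Sigma$ is a set $\mathcal{U}$ of conditional quantitative equations containing (for all variables and rationals $\varepsilon,\varepsilon'\ge 0$) $\vdash x=_0x$; $\{x=_\varepsilon y\}\vdash y=_\varepsilon x$; $\{x=_\varepsilon z,z=_{\varepsilon'}y\}\vdash x=_{\varepsilon+\varepsilon'}y$; $\{x=_\varepsilon y\}\vdash x=_{\varepsilon+\varepsilon'}y$ for $\varepsilon'>0$; $\{x_i=_\varepsilon y_i\mid i=1,\dots,n\}\vdash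 f(x_1,\dots,x_n)=_\varepsilon f(y_1,\dots,y_n)$ for $f:n\in\Sigma$; and closed under: continuity (if $\Gamma\vdash t=_{\varepsilon'}s\in\mathcal{U}$ for all $\varepsilon'>\varepsilon$ then $\Gamma\vdash t=_\varepsilon s\in\mathcal{U}$), substitution of terms for variables, assumption ($\Gamma\vdash\phi\in\mathcal{U}$ whenever $\phi\in\Gamma$), and cut (if $\Gamma\vdash\phi\in\mathcal{U}$ for all $\phi\in\Theta$ and $\Theta\vdash\psi\in\mathcal{U}$ then $\Gamma\vdash\psi\in\mathcal{U}$). A set $A$ of conditional quantitative equations axiomatizes $\mathcal{U}$ if $\mathcal{U}$ is the smallest theory containing $A$. Models. A quantitative $\Sigma$-algebra is an extended metric space $A$ with, for each $f:n\in\Sigma$, a map $f^A:A^n\to A$ that is non-expansive for the max metric on $A^n$. It satisfies $\Gamma\vdash t=_\varepsilon s$ if for every assignment $\iota:V\to A$ (extended homomorphically to terms), $d_A(\iota(t'),\iota(s'))\le\varepsilon'$ for all $t'=_{\varepsilon'}s'\in\Gamma$ implies $d_A(\iota(t),\iota(s))\le\varepsilon$. $\mathbb{K}(\Sigma,\mathcal{U})$ is the category of quantitative $\Sigma$-algebras satisfying all members of $\mathcal{U}$, with non-expansive $\Sigma$-homomorphisms. The forgetful functor $\mathbb{K}(\Sigma,\mathcal{U})\to\mathbf{Met}$ has a left adjoint (known result); $T_{\mathcal{U}}$ denotes the induced monad on $\mathbf{Met}$. Writer theory. $\mathcal{W}$ has signature $\{\mathsf{w}_\alpha:1\mid\alpha\in\Lambda\}$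 and is axiomatized by, for all $\alpha,\alpha'\in\Lambda$: $\vdash x=_0\mathsf{w}_0(x)$; $\ \vdash\mathsf{w}_\alpha(\mathsf{w}_{\alpha'}(x))=_0\mathsf{w}_{\alpha*\alpha'}(x)$; $\ \{x=_\varepsilon x'\}\vdash\mathsf{w}_\alpha(x)=_\delta\mathsf{w}_{\alpha'}(x')$ for all $\varepsilon,\delta\in\mathbb{Q}_{\ge0}$ with $\delta\ge d_\Lambda(\alpha,\alpha')+\varepsilon$. Writer monad. $X\square Y$ is $X\times Y$ with $d((x,y),(x',y'))=d_X(x,x')+d_Y(y,y')$. The functor $\Lambda\square-$ acts on morphisms by $(\alpha,x)\mapsto(\alpha,f(x))$; unit $\tau_X(x)=(0,x)$; multiplication $\varsigma_X(\alpha,(\alpha',x))=(\alpha*\alpha',x)$. -}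

module Defs where

open import Level using (Level; _⊔_; suc; Lift; lift; lower)
open import Data.Nat.Base using (ℕ)
open import Data.Vec.Functional using (Vector)
open import Data.List.Base using (List; []; _∷_; [_]; map; tabulate)
open import Data.List.Membership.Propositional using (_∈_)
open import Data.Product.Base using (_×_; _,_; proj₁; proj₂; ∃; ∃₂)
open import Data.Rational.Base as ℚ using (ℚ; 0ℚ)
import Data.Rational.Properties as ℚ
open import Relation.Binary.Bundles using (Setoid)
open import Relation.Binary.Structures using (IsEquivalence)
open import Relation.Binary.PropositionalEquality as ≡ using (_≡_; refl; cong; subst)
open import Relation.Nullary.Decidable.Core using (recompute)
open import Algebra.Structures using (IsMonoid)

private
  variable
    ℓ : Level

record ℚ≥0 : Set where
  constructor mkℚ≥0
  field
    value   : ℚ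
    .nonNeg : 0ℚ ℚ.≤ value

open ℚ≥0 public using (value)

infix  4 _≤ᵠ_ _<ᵠ_
infixl 6 _+ᵠ_

_≤ᵠ_ _<ᵠ_ : ℚ≥0 → ℚ≥0 → Set
p ≤ᵠ q = value p ℚ.≤ value q
p <ᵠ q = value p ℚ.< value q

0ᵠ : ℚ≥0
0ᵠ = mkℚ≥0 0ℚ ℚ.≤-refl

0≤ᵠ : ∀ q → 0ᵠ ≤ᵠ q
0≤ᵠ (mkℚ≥0 q 0≤q) = recompute (0ℚ ℚ.≤? q) 0≤q

_+ᵠ_ : ℚ≥0 → ℚ≥0 → ℚ≥0
p +ᵠ q = mkℚ≥0 (value p ℚ.+ value q) (ℚ.+-mono-≤ (0≤ᵠ p) (0≤ᵠ q))

≤ᵠ+ˡ : ∀ p q → p ≤ᵠ p +ᵠ q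
≤ᵠ+ˡ p q = subst (ℚ._≤ value p ℚ.+ value q) (ℚ.+-identityʳ (value p))
  (ℚ.+-mono-≤ (ℚ.≤-refl {value p}) (0≤ᵠ q))

≤ᵠ+ʳ : ∀ p q → q ≤ᵠ p +ᵠ q
≤ᵠ+ʳ p q = subst (ℚ._≤ value p ℚ.+ value q) (ℚ.+-identityˡ (value q))
  (ℚ.+-mono-≤ (0≤ᵠ p) (ℚ.≤-refl {value q}))

<ᵠ-dense : ∀ p q → p <ᵠ q → ∃ λ m → p <ᵠ m × m <ᵠ q
<ᵠ-dense p q p<q =
  let (m , p<m , m<q) = ℚ.<-dense p<q
  in mkℚ≥0 m (ℚ.<⇒≤ (ℚ.≤-<-trans (0≤ᵠ p) p<m)) , p<m , m<q

<ᵠ-shift : ∀ u v p → u +ᵠ v <ᵠ p → ∃ λ u′ → u <ᵠ u′ × value (u′ +ᵠ v) ≡ value p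
<ᵠ-shift u v p u+v<p =
  mkℚ≥0 w (ℚ.<⇒≤ (ℚ.≤-<-trans (0≤ᵠ u) u<w)) , u<w , w+v≡p
  where
  w = value p ℚ.+ (ℚ.- value v)

  u<w : value u ℚ.< w
  u<w = subst (ℚ._< w)
    (≡.trans (ℚ.+-assoc (value u) (value v) (ℚ.- value v))
      (≡.trans (cong (value u ℚ.+_) (ℚ.+-inverseʳ (value v))) (ℚ.+-identityʳ (value u))))
    (ℚ.+-mono-<-≤ u+v<p (ℚ.≤-refl {ℚ.- value v}))

  w+v≡p : w ℚ.+ value v ≡ value p
  w+v≡p = ≡.trans (ℚ.+-assoc (value p) (ℚ.- value v) (value v))
    (≡.trans (cong (value p ℚ.+_) (ℚ.+-inverseˡ (value v))) (ℚ.+-identityʳ (value p)))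

-- An element r of the extended interval [0,∞] is given by the set { q ∈ ℚ≥0 | r ≤ q }
-- of its rational upper bounds (an upper real).  Classically such sets
-- are exactly the subsets of ℚ≥0 satisfying `upper` and `closed`; r is
-- the infimum, and ∞ is the empty set.
record [0,∞] ℓ : Set (suc ℓ) where
  field
    bound  : ℚ≥0 → Set ℓ
    upper  : ∀ p q → p ≤ᵠ q → bound p → bound q
    closed : ∀ q → (∀ p → q <ᵠ p → bound p) → bound q

open [0,∞] using (upper; closed)

infix  4 _≤ℚ_ _≤_ _≃_
infixl 6 _+_

_≤ℚ_ : [0,∞] ℓ → ℚ≥0 → Set ℓ
_≤ℚ_ = [0,∞].bound

_≤_ _≃_ : [0,∞] ℓ → [0,∞] ℓ → Set ℓ
r ≤ s = ∀ q → s ≤ℚ q → r ≤ℚ q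
r ≃ s = r ≤ s × s ≤ r

⌜_⌝ : ℚ≥0 → [0,∞] ℓ
⌜ p ⌝ = record
  { bound  = λ q → Lift _ (p ≤ᵠ q)
  ; upper  = λ _ _ q≤q′ (lift p≤q) → lift (ℚ.≤-trans p≤q q≤q′)
  ; closed = λ q h → lift (ℚ.≮⇒≥ λ q<p →
      let (m , q<m , m<p) = <ᵠ-dense q p q<p
      in ℚ.<-irrefl refl (ℚ.<-≤-trans m<p (lower (h m q<m))))
  }

-- r + s ≤ q iff every rational p > q dominates u + v for some rational
-- upper bounds u of r and v of s.
_+_ : [0,∞] ℓ → [0,∞] ℓ → [0,∞] ℓ
r + s = record
  { bound  = λ q → ∀ p → q <ᵠ p → ∃₂ λ u v → r ≤ℚ u × s ≤ℚ v × u +ᵠ v ≤ᵠ p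
  ; upper  = λ _ _ q≤q′ h p q′<p → h p (ℚ.≤-<-trans q≤q′ q′<p)
  ; closed = λ q h p q<p →
      let (m , q<m , m<p) = <ᵠ-dense q p q<p in h m q<m p m<p
  }

-- The maximum, which is 0 for n = 0.
⨆ : ∀ {n} → Vector ([0,∞] ℓ) n → [0,∞] ℓ
⨆ r = record
  { bound  = λ q → ∀ i → r i ≤ℚ q
  ; upper  = λ p q p≤q h i → upper (r i) p q p≤q (h i)
  ; closed = λ q h i → closed (r i) q λ p q<p → h p q<p i
  }

module _ (r : [0,∞] ℓ) where

  ≤ℚ-resp : ∀ p q → value p ≡ value q → r ≤ℚ p → r ≤ℚ q
  ≤ℚ-resp p q p≡q = upper r p q (ℚ.≤-reflexive p≡q)

  ≤0⇒≃0 : r ≤ℚ 0ᵠ → r ≃ ⌜ 0ᵠ ⌝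
  ≤0⇒≃0 h = (λ q (lift 0≤q) → upper r 0ᵠ q 0≤q h) , λ q _ → lift (0≤ᵠ q)

  ≃0⇒≤0 : r ≃ ⌜ 0ᵠ ⌝ → r ≤ℚ 0ᵠ
  ≃0⇒≤0 (h , _) = h 0ᵠ (lift ℚ.≤-refl)

  shiftʳ : ℚ≥0 → [0,∞] ℓ
  shiftʳ v = record
    { bound  = λ u → r ≤ℚ u +ᵠ v
    ; upper  = λ u u′ u≤u′ →
        upper r (u +ᵠ v) (u′ +ᵠ v) (ℚ.+-mono-≤ u≤u′ (ℚ.≤-refl {value v}))
    ; closed = λ u h → closed r (u +ᵠ v) λ p u+v<p →
        let (u′ , u<u′ , eq) = <ᵠ-shift u v p u+v<p
        in ≤ℚ-resp (u′ +ᵠ v) p eq (h u′ u<u′)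
    }

  shiftˡ : ℚ≥0 → [0,∞] ℓ
  shiftˡ u = record
    { bound  = λ v → r ≤ℚ u +ᵠ v
    ; upper  = λ v v′ v≤v′ →
        upper r (u +ᵠ v) (u +ᵠ v′) (ℚ.+-mono-≤ (ℚ.≤-refl {value u}) v≤v′)
    ; closed = λ v h →
        ≤ℚ-resp (v +ᵠ u) (u +ᵠ v) (ℚ.+-comm (value v) (value u))
          (closed (shiftʳ u) v λ p v<p →
            ≤ℚ-resp (u +ᵠ p) (p +ᵠ u) (ℚ.+-comm (value u) (value p)) (h p v<p))
    }

+-intro : ∀ (r s : [0,∞] ℓ) u v → r ≤ℚ u → s ≤ℚ v → r + s ≤ℚ u +ᵠ v
+-intro r s u v r≤u s≤v _ u+v<p = u , v , r≤u , s≤v , ℚ.<⇒≤ u+v<p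

+-elim : ∀ (r s t : [0,∞] ℓ) → (∀ u v → r ≤ℚ u → s ≤ℚ v → t ≤ℚ u +ᵠ v) → t ≤ r + s
+-elim r s t h q r+s≤q = closed t q λ p q<p →
  let (u , v , r≤u , s≤v , u+v≤p) = r+s≤q p q<p
  in upper t (u +ᵠ v) p u+v≤p (h u v r≤u s≤v)

+-mono : ∀ (r r′ s s′ : [0,∞] ℓ) → r ≤ r′ → s ≤ s′ → r + s ≤ r′ + s′
+-mono r r′ s s′ r≤r′ s≤s′ = +-elim r′ s′ (r + s) λ u v r′≤u s′≤v →
  +-intro r s u v (r≤r′ u r′≤u) (s≤s′ v s′≤v)

+-assoc-≤ : ∀ (r s t : [0,∞] ℓ) → (r + s) + t ≤ r + (s + t)
+-assoc-≤ r s t = +-elim r (s + t) ((r + s) + t) λ u v r≤u →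
  +-elim s t (shiftˡ ((r + s) + t) u) (λ v w s≤v t≤w →
    ≤ℚ-resp ((r + s) + t) ((u +ᵠ v) +ᵠ w) (u +ᵠ (v +ᵠ w))
      (ℚ.+-assoc (value u) (value v) (value w))
      (+-intro (r + s) t (u +ᵠ v) w (+-intro r s u v r≤u s≤v) t≤w))
    v

private
  ℚ-interchange : ∀ a b c d → (a ℚ.+ c) ℚ.+ (b ℚ.+ d) ≡ (a ℚ.+ b) ℚ.+ (c ℚ.+ d)
  ℚ-interchange a b c d = begin
    (a ℚ.+ c) ℚ.+ (b ℚ.+ d) ≡⟨ ℚ.+-assoc a c (b ℚ.+ d) ⟩
    a ℚ.+ (c ℚ.+ (b ℚ.+ d)) ≡⟨ cong (a ℚ.+_) (ℚ.+-assoc c b d) ⟨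
    a ℚ.+ ((c ℚ.+ b) ℚ.+ d) ≡⟨ cong (λ x → a ℚ.+ (x ℚ.+ d)) (ℚ.+-comm c b) ⟩
    a ℚ.+ ((b ℚ.+ c) ℚ.+ d) ≡⟨ cong (a ℚ.+_) (ℚ.+-assoc b c d) ⟩
    a ℚ.+ (b ℚ.+ (c ℚ.+ d)) ≡⟨ ℚ.+-assoc a b (c ℚ.+ d) ⟨
    (a ℚ.+ b) ℚ.+ (c ℚ.+ d) ∎
    where open ≡.≡-Reasoning

+-interchange-≤ : ∀ (a b c d : [0,∞] ℓ) → (a + c) + (b + d) ≤ (a + b) + (c + d)
+-interchange-≤ a b c d = +-elim (a + b) (c + d) t λ x y a+b≤x c+d≤y →
  +-elim a b (shiftʳ t y) (λ p q a≤p b≤q →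
    +-elim c d (shiftˡ t (p +ᵠ q)) (λ r s c≤r d≤s →
      ≤ℚ-resp t ((p +ᵠ r) +ᵠ (q +ᵠ s)) ((p +ᵠ q) +ᵠ (r +ᵠ s))
        (ℚ-interchange (value p) (value q) (value r) (value s))
        (+-intro (a + c) (b + d) (p +ᵠ r) (q +ᵠ s)
          (+-intro a c p r a≤p c≤r) (+-intro b d q s b≤q d≤s)))
      y c+d≤y)
    x a+b≤x
  where t = (a + c) + (b + d)

-- Hom-sets of a category are setoids.
record Category (o h e : Level) : Set (suc (o ⊔ h ⊔ e)) where
  infix  4 _≈_ _⇒_
  infixr 9 _∘_
  field
    Obj     : Set o
    _⇒_     : Obj → Obj → Set h
    _≈_     : ∀ {A B} → A ⇒ B → A ⇒ B → Set e
    id      : ∀ {A} → A ⇒ A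
    _∘_     : ∀ {A B C} → B ⇒ C → A ⇒ B → A ⇒ C
    equiv   : ∀ {A B} → IsEquivalence (_≈_ {A} {B})
    ∘-resp  : ∀ {A B C} {f f′ : B ⇒ C} {g g′ : A ⇒ B} → f ≈ f′ → g ≈ g′ → f ∘ g ≈ f′ ∘ g′
    assoc   : ∀ {A B C D} {f : C ⇒ D} {g : B ⇒ C} {h : A ⇒ B} → (f ∘ g) ∘ h ≈ f ∘ (g ∘ h)
    idˡ     : ∀ {A B} {f : A ⇒ B} → id ∘ f ≈ f
    idʳ     : ∀ {A B} {f : A ⇒ B} → f ∘ id ≈ f

  homSetoid : Obj → Obj → Setoid h e
  homSetoid A B = record { isEquivalence = equiv {A} {B} }

private
  variable
    o h e o′ h′ e′ : Level

record Functor (C : Category o h e) (D : Category o′ h′ e′) : Set (o ⊔ h ⊔ e ⊔ o′ ⊔ h′ ⊔ e′) where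
  private
    module C = Category C
    module D = Category D
  field
    F₀     : C.Obj → D.Obj
    F₁     : ∀ {A B} → A C.⇒ B → F₀ A D.⇒ F₀ B
    F-resp : ∀ {A B} {f g : A C.⇒ B} → f C.≈ g → F₁ f D.≈ F₁ g
    F-id   : ∀ {A} → F₁ (C.id {A}) D.≈ D.id
    F-∘    : ∀ {A B E} {f : B C.⇒ E} {g : A C.⇒ B} → F₁ (f C.∘ g) D.≈ F₁ f D.∘ F₁ g

open Functor

idF : (C : Category o h e) → Functor C C
idF C = record
  { F₀ = λ A → A ; F₁ = λ f → f ; F-resp = λ p → p
  ; F-id = IsEquivalence.refl equiv ; F-∘ = IsEquivalence.refl equiv }
  where open Category C

module _ {o″ h″ e″} {C : Category o h e} {D : Category o′ h′ e′} {E : Category o″ h″ e″} where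

  infixr 9 _∘F_
  _∘F_ : Functor D E → Functor C D → Functor C E
  G ∘F F = record
    { F₀     = λ A → F₀ G (F₀ F A)
    ; F₁     = λ f → F₁ G (F₁ F f)
    ; F-resp = λ p → F-resp G (F-resp F p)
    ; F-id   = IsEquivalence.trans equiv (F-resp G (F-id F)) (F-id G)
    ; F-∘    = IsEquivalence.trans equiv (F-resp G (F-∘ F)) (F-∘ G)
    }
    where open Category E

record NatTrans {C : Category o h e} {D : Category o′ h′ e′} (F G : Functor C D)
       : Set (o ⊔ h ⊔ h′ ⊔ e′) where
  private
    module C = Category C
    module D = Category D
  field
    at      : ∀ A → F₀ F A D.⇒ F₀ G A
    natural : ∀ {A B} (f : A C.⇒ B) → at B D.∘ F₁ F f D.≈ F₁ G f D.∘ at A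

open NatTrans

record _⊣_ {C : Category o h e} {D : Category o′ h′ e′} (L : Functor C D) (R : Functor D C)
       : Set (o ⊔ h ⊔ e ⊔ o′ ⊔ h′ ⊔ e′) where
  private
    module C = Category C
    module D = Category D
  field
    unit   : NatTrans (idF C) (R ∘F L)
    counit : NatTrans (L ∘F R) (idF D)
    zig    : ∀ {A} → at counit (F₀ L A) D.∘ F₁ L (at unit A) D.≈ D.id
    zag    : ∀ {B} → F₁ R (at counit B) C.∘ at unit (F₀ R B) C.≈ C.id

record Monad (C : Category o h e) : Set (o ⊔ h ⊔ e) where
  open Category C
  field
    T         : Functor C C
    η         : NatTrans (idF C) T
    μ         : NatTrans (T ∘F T) T
    μ-assoc   : ∀ {A} → at μ A ∘ F₁ T (at μ A) ≈ at μ A ∘ at μ (F₀ T A)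
    μ-unitˡ   : ∀ {A} → at μ A ∘ at η (F₀ T A) ≈ id
    μ-unitʳ   : ∀ {A} → at μ A ∘ F₁ T (at η A) ≈ id

record MonadMorphism {C : Category o h e} (M N : Monad C) : Set (o ⊔ h ⊔ e) where
  open Category C
  private
    module M = Monad M
    module N = Monad N
  field
    transf     : NatTrans M.T N.T
    preserve-η : ∀ {A} → at transf A ∘ at M.η A ≈ at N.η A
    preserve-μ : ∀ {A} → at transf A ∘ at M.μ A ≈ at N.μ A ∘ F₁ N.T (at transf A) ∘ at transf (F₀ M.T A)

record _≅_ {C : Category o h e} (M N : Monad C) : Set (o ⊔ h ⊔ e) where
  open Category C
  open MonadMorphism
  field
    to      : MonadMorphism M N
    from    : MonadMorphism N M
    to∘from : ∀ {A} → at (transf to) A ∘ at (transf from) A ≈ id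
    from∘to : ∀ {A} → at (transf from) A ∘ at (transf to) A ≈ id

module _ {C : Category o h e} {D : Category o′ h′ e′} {L : Functor C D} {R : Functor D C} where

  inducedMonad : L ⊣ R → Monad C
  inducedMonad adj = record
    { T       = R ∘F L
    ; η       = unit
    ; μ       = record
      { at      = λ A → F₁ R (at counit (F₀ L A))
      ; natural = λ f → under-R (natural counit (F₁ L f))
      }
    ; μ-assoc = under-R (natural counit (at counit _))
    ; μ-unitˡ = zag
    ; μ-unitʳ = C.equiv .IsEquivalence.trans (C.equiv .IsEquivalence.sym (F-∘ R))
                  (C.equiv .IsEquivalence.trans (F-resp R zig) (F-id R))
    }
    where
    module C = Category C
    module D = Category D
    open _⊣_ adj

    under-R : ∀ {A B B′ E} {f : B D.⇒ E} {g : A D.⇒ B} {f′ : B′ D.⇒ E} {g′ : A D.⇒ B′} →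
              f D.∘ g D.≈ f′ D.∘ g′ → F₁ R f C.∘ F₁ R g C.≈ F₁ R f′ C.∘ F₁ R g′
    under-R p = C.equiv .IsEquivalence.trans (C.equiv .IsEquivalence.sym (F-∘ R))
                  (C.equiv .IsEquivalence.trans (F-resp R p) (F-∘ R))

-- The underlying set is a setoid, since carriers given by quotients
-- (free algebras) are needed.
record ExtMetricSpace ℓ : Set (suc ℓ) where
  no-eta-equality
  constructor mkExtMetricSpace
  infix 4 _≈_
  field
    Carrier       : Set ℓ
    _≈_           : Carrier → Carrier → Set ℓ
    isEquivalence : IsEquivalence _≈_
    d             : Carrier → Carrier → [0,∞] ℓ
    d≃0⇒≈         : ∀ {x y} → d x y ≃ ⌜ 0ᵠ ⌝ → x ≈ y
    ≈⇒d≃0         : ∀ {x y} → x ≈ y → d x y ≃ ⌜ 0ᵠ ⌝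
    d-sym         : ∀ x y → d x y ≃ d y x
    d-triangle    : ∀ x y z → d x z ≤ d x y + d y z

  open IsEquivalence isEquivalence public
    renaming (refl to ≈-refl; sym to ≈-sym; trans to ≈-trans)

  ≈⇒≤0 : ∀ {x y} → x ≈ y → d x y ≤ℚ 0ᵠ
  ≈⇒≤0 {x} {y} x≈y = ≃0⇒≤0 (d x y) (≈⇒d≃0 x≈y)

  ≤0⇒≈ : ∀ {x y} → d x y ≤ℚ 0ᵠ → x ≈ y
  ≤0⇒≈ {x} {y} h = d≃0⇒≈ (≤0⇒≃0 (d x y) h)

  d-triangle-ℚ : ∀ x y z p q → d x y ≤ℚ p → d y z ≤ℚ q → d x z ≤ℚ p +ᵠ q
  d-triangle-ℚ x y z p q h k =
    d-triangle x y z (p +ᵠ q) (+-intro (d x y) (d y z) p q h k)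

  d-resp : ∀ {x x′ y y′} → x ≈ x′ → y ≈ y′ → d x y ≤ d x′ y′
  d-resp {x} {x′} {y} {y′} x≈x′ y≈y′ q h =
    ≤ℚ-resp (d x y) (0ᵠ +ᵠ (q +ᵠ 0ᵠ)) q
      (≡.trans (ℚ.+-identityˡ (value q ℚ.+ 0ℚ)) (ℚ.+-identityʳ (value q)))
      (d-triangle-ℚ x x′ y 0ᵠ (q +ᵠ 0ᵠ) (≈⇒≤0 x≈x′)
        (d-triangle-ℚ x′ y′ y q 0ᵠ h (≈⇒≤0 (≈-sym y≈y′))))

open ExtMetricSpace using (Carrier; d)
-- Turns definitions by a record expression into copattern clauses, so
-- that conversion checking does not unfold concrete spaces.
{-# INLINE mkExtMetricSpace #-}

record NonExpansive (X Y : ExtMetricSpace ℓ) : Set ℓ where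
  field
    fun          : Carrier X → Carrier Y
    nonExpansive : ∀ x y → d Y (fun x) (fun y) ≤ d X x y

  private
    module X = ExtMetricSpace X
    module Y = ExtMetricSpace Y

  fun-cong : ∀ {x y} → x X.≈ y → fun x Y.≈ fun y
  fun-cong {x} {y} x≈y = Y.≤0⇒≈ (nonExpansive x y 0ᵠ (X.≈⇒≤0 x≈y))

open NonExpansive

idN : {X : ExtMetricSpace ℓ} → NonExpansive X X
idN = record { fun = λ x → x ; nonExpansive = λ _ _ _ h → h }

infixr 9 _∘N_
_∘N_ : {X Y Z : ExtMetricSpace ℓ} → NonExpansive Y Z → NonExpansive X Y → NonExpansive X Z
g ∘N f = record
  { fun          = λ x → fun g (fun f x)
  ; nonExpansive = λ x y q h → nonExpansive g (fun f x) (fun f y) q (nonExpansive f x y q h)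
  }

Met : ∀ ℓ → Category (suc ℓ) ℓ ℓ
Met ℓ = record
  { Obj    = ExtMetricSpace ℓ
  ; _⇒_    = NonExpansive
  ; _≈_    = λ {X} {Y} f g → ∀ x → ExtMetricSpace._≈_ Y (fun f x) (fun g x)
  ; id     = idN
  ; _∘_    = _∘N_
  ; equiv  = λ {X} {Y} → let open ExtMetricSpace Y in record
    { refl  = λ _ → ≈-refl
    ; sym   = λ p x → ≈-sym (p x)
    ; trans = λ p q x → ≈-trans (p x) (q x)
    }
  ; ∘-resp = λ {_} {_} {Z} {f} {f′} {g} {g′} p q x →
      ExtMetricSpace.≈-trans Z (fun-cong f (q x)) (p (fun g′ x))
  ; assoc  = λ {_} {_} {_} {W} _ → ExtMetricSpace.≈-refl W
  ; idˡ    = λ {_} {Y} _ → ExtMetricSpace.≈-refl Y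
  ; idʳ    = λ {_} {Y} _ → ExtMetricSpace.≈-refl Y
  }

infix 10 _^_
_^_ : ExtMetricSpace ℓ → ℕ → ExtMetricSpace ℓ
A ^ n = record
  { Carrier       = Vector A.Carrier n
  ; _≈_           = λ x y → ∀ i → x i A.≈ y i
  ; isEquivalence = record
    { refl  = λ _ → A.≈-refl
    ; sym   = λ p i → A.≈-sym (p i)
    ; trans = λ p q i → A.≈-trans (p i) (q i)
    }
  ; d             = dⁿ
  ; d≃0⇒≈         = λ {x} {y} p i → A.≤0⇒≈ (≃0⇒≤0 (dⁿ x y) p i)
  ; ≈⇒d≃0         = λ {x} {y} p → ≤0⇒≃0 (dⁿ x y) λ i → A.≈⇒≤0 (p i)
  ; d-sym         = λ x y → (λ q h i → proj₁ (A.d-sym (x i) (y i)) q (h i))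
                          , (λ q h i → proj₂ (A.d-sym (x i) (y i)) q (h i))
  ; d-triangle    = λ x y z → +-elim (dⁿ x y) (dⁿ y z) (dⁿ x z) λ u v h k i →
      A.d-triangle-ℚ (x i) (y i) (z i) u v (h i) (k i)
  }
  where
  module A = ExtMetricSpace A
  dⁿ : Vector A.Carrier n → Vector A.Carrier n → [0,∞] _
  dⁿ x y = ⨆ λ i → A.d (x i) (y i)

infixr 7 _□_
_□_ : ExtMetricSpace ℓ → ExtMetricSpace ℓ → ExtMetricSpace ℓ
X □ Y = record
  { Carrier       = X.Carrier × Y.Carrier
  ; _≈_           = λ (x , y) (x′ , y′) → x X.≈ x′ × y Y.≈ y′
  ; isEquivalence = record
    { refl  = X.≈-refl , Y.≈-refl
    ; sym   = λ (p , q) → X.≈-sym p , Y.≈-sym q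
    ; trans = λ (p , q) (p′ , q′) → X.≈-trans p p′ , Y.≈-trans q q′
    }
  ; d             = d□
  ; d≃0⇒≈         = λ {a} {b} p → let h = ≃0⇒≤0 (d□ a b) p in
      X.≤0⇒≈ (closed (X.d (proj₁ a) (proj₁ b)) 0ᵠ λ p 0<p →
        let (u , v , r≤u , _ , u+v≤p) = h p 0<p
        in upper (X.d (proj₁ a) (proj₁ b)) u p (ℚ.≤-trans (≤ᵠ+ˡ u v) u+v≤p) r≤u)
    , Y.≤0⇒≈ (closed (Y.d (proj₂ a) (proj₂ b)) 0ᵠ λ p 0<p →
        let (u , v , _ , s≤v , u+v≤p) = h p 0<p
        in upper (Y.d (proj₂ a) (proj₂ b)) v p (ℚ.≤-trans (≤ᵠ+ʳ u v) u+v≤p) s≤v)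
  ; ≈⇒d≃0         = λ {a} {b} (p , q) → ≤0⇒≃0 (d□ a b)
      (≤ℚ-resp (d□ a b) (0ᵠ +ᵠ 0ᵠ) 0ᵠ refl
        (+-intro (X.d (proj₁ a) (proj₁ b)) (Y.d (proj₂ a) (proj₂ b)) 0ᵠ 0ᵠ
          (X.≈⇒≤0 p) (Y.≈⇒≤0 q)))
  ; d-sym         = λ a b → d□-sym a b , d□-sym b a
  ; d-triangle    = λ (x , y) (x′ , y′) (x″ , y″) q h →
      +-mono (X.d x x″) (X.d x x′ + X.d x′ x″) (Y.d y y″) (Y.d y y′ + Y.d y′ y″)
        (X.d-triangle x x′ x″) (Y.d-triangle y y′ y″) q
        (+-interchange-≤ (X.d x x′) (Y.d y y′) (X.d x′ x″) (Y.d y′ y″) q h)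
  }
  where
  module X = ExtMetricSpace X
  module Y = ExtMetricSpace Y

  d□ : X.Carrier × Y.Carrier → X.Carrier × Y.Carrier → [0,∞] _
  d□ (x , y) (x′ , y′) = X.d x x′ + Y.d y y′

  d□-sym : ∀ a b → d□ a b ≤ d□ b a
  d□-sym (x , y) (x′ , y′) = +-mono (X.d x x′) (X.d x′ x) (Y.d y y′) (Y.d y′ y)
    (proj₁ (X.d-sym x x′)) (proj₁ (Y.d-sym y y′))

record Signature ℓ : Set (suc ℓ) where
  field
    Symbol : Set ℓ
    arity  : Symbol → ℕ

open Signature

-- Argument tuples are functions, so tuples that agree pointwise need not
-- be ≡; the corresponding terms have distance 0 in every theory, by
-- non-expansiveness of the symbols.
data Term (S : Signature ℓ) {v} (X : Set v) : Set (ℓ ⊔ v) where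
  var : X → Term S X
  op  : (f : Symbol S) → Vector (Term S X) (arity S f) → Term S X

module _ {S : Signature ℓ} {v w} {X : Set v} {Y : Set w} where

  foldTerm : (∀ f → Vector Y (arity S f) → Y) → (X → Y) → Term S X → Y
  foldTerm α ι (var x)   = ι x
  foldTerm α ι (op f ts) = α f λ i → foldTerm α ι (ts i)

infixl 8 _[_]ᵗ
_[_]ᵗ : ∀ {S : Signature ℓ} {v w} {X : Set v} {Y : Set w} → Term S X → (X → Term S Y) → Term S Y
t [ σ ]ᵗ = foldTerm op σ t

V : Set
V = ℕ

infix 5 _=⟨_⟩_
record QEquation (S : Signature ℓ) : Set ℓ where
  constructor _=⟨_⟩_
  field
    lhs : Term S V
    ε   : ℚ≥0
    rhs : Term S V

-- The finite set of premises is represented by a list, used only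
-- through its membership relation.
infix 4 _⊢_
record CQEquation (S : Signature ℓ) : Set ℓ where
  constructor _⊢_
  field
    premises   : List (QEquation S)
    conclusion : QEquation S

_[_]ᵉ : {S : Signature ℓ} → QEquation S → (V → Term S V) → QEquation S
(t =⟨ ε ⟩ s) [ σ ]ᵉ = t [ σ ]ᵗ =⟨ ε ⟩ s [ σ ]ᵗ

record IsTheory (S : Signature ℓ) {m} (U : CQEquation S → Set m) : Set (ℓ ⊔ m) where
  field
    reflexivity  : ∀ x → U ([] ⊢ var x =⟨ 0ᵠ ⟩ var x)
    symmetry     : ∀ x y ε → U ([ var x =⟨ ε ⟩ var y ] ⊢ var y =⟨ ε ⟩ var x)
    triangle     : ∀ x y z ε ε′ →
                   U ((var x =⟨ ε ⟩ var z) ∷ (var z =⟨ ε′ ⟩ var y) ∷ [] ⊢ var x =⟨ ε +ᵠ ε′ ⟩ var y)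
    weakening    : ∀ x y ε ε′ → 0ᵠ <ᵠ ε′ →
                   U ([ var x =⟨ ε ⟩ var y ] ⊢ var x =⟨ ε +ᵠ ε′ ⟩ var y)
    nonExpansivity : ∀ f (x y : Vector V (arity S f)) ε →
                   U (tabulate (λ i → var (x i) =⟨ ε ⟩ var (y i))
                      ⊢ op f (λ i → var (x i)) =⟨ ε ⟩ op f (λ i → var (y i)))
    continuity   : ∀ Γ t s ε → (∀ ε′ → ε <ᵠ ε′ → U (Γ ⊢ t =⟨ ε′ ⟩ s)) → U (Γ ⊢ t =⟨ ε ⟩ s)
    substitution : ∀ Γ φ (σ : V → Term S V) → U (Γ ⊢ φ) → U (map _[ σ ]ᵉ Γ ⊢ φ [ σ ]ᵉ)
    assumption   : ∀ Γ φ → φ ∈ Γ → U (Γ ⊢ φ)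
    cut          : ∀ Γ Θ ψ → (∀ φ → φ ∈ Θ → U (Γ ⊢ φ)) → U (Θ ⊢ ψ) → U (Γ ⊢ ψ)

record Theory (S : Signature ℓ) : Set (suc ℓ) where
  field
    Member   : CQEquation S → Set ℓ
    isTheory : IsTheory S Member

open Theory

-- The least theory containing A, that is, the theory axiomatized by A.
data Derivable {S : Signature ℓ} (A : CQEquation S → Set ℓ) : CQEquation S → Set ℓ where
  axm          : ∀ {φ} → A φ → Derivable A φ
  reflexivity  : ∀ x → Derivable A ([] ⊢ var x =⟨ 0ᵠ ⟩ var x)
  symmetry     : ∀ x y ε → Derivable A ([ var x =⟨ ε ⟩ var y ] ⊢ var y =⟨ ε ⟩ var x)
  triangle     : ∀ x y z ε ε′ →
                 Derivable A ((var x =⟨ ε ⟩ var z) ∷ (var z =⟨ ε′ ⟩ var y) ∷ [] ⊢ var x =⟨ ε +ᵠ ε′ ⟩ var y)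
  weakening    : ∀ x y ε ε′ → 0ᵠ <ᵠ ε′ →
                 Derivable A ([ var x =⟨ ε ⟩ var y ] ⊢ var x =⟨ ε +ᵠ ε′ ⟩ var y)
  nonExpansivity : ∀ f (x y : Vector V (arity S f)) ε →
                 Derivable A (tabulate (λ i → var (x i) =⟨ ε ⟩ var (y i))
                              ⊢ op f (λ i → var (x i)) =⟨ ε ⟩ op f (λ i → var (y i)))
  continuity   : ∀ Γ t s ε → (∀ ε′ → ε <ᵠ ε′ → Derivable A (Γ ⊢ t =⟨ ε′ ⟩ s)) →
                 Derivable A (Γ ⊢ t =⟨ ε ⟩ s)
  substitution : ∀ Γ φ (σ : V → Term S V) → Derivable A (Γ ⊢ φ) →
                 Derivable A (map _[ σ ]ᵉ Γ ⊢ φ [ σ ]ᵉ)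
  assumption   : ∀ Γ φ → φ ∈ Γ → Derivable A (Γ ⊢ φ)
  cut          : ∀ Γ Θ ψ → (∀ φ → φ ∈ Θ → Derivable A (Γ ⊢ φ)) → Derivable A (Θ ⊢ ψ) →
                 Derivable A (Γ ⊢ ψ)

module _ {S : Signature ℓ} (A : CQEquation S → Set ℓ) where

  theoryOf : Theory S
  theoryOf = record
    { Member   = Derivable A
    ; isTheory = record
      { reflexivity = reflexivity ; symmetry = symmetry ; triangle = triangle
      ; weakening = weakening ; nonExpansivity = nonExpansivity ; continuity = continuity
      ; substitution = substitution ; assumption = assumption ; cut = cut }
    }

  theoryOf-least : ∀ {m} (U : CQEquation S → Set m) → IsTheory S U →
                   (∀ {φ} → A φ → U φ) → ∀ {φ} → Derivable A φ → U φ
  theoryOf-least U isT A⊆U = go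
    where
    module U = IsTheory isT
    go : ∀ {φ} → Derivable A φ → U φ
    go (axm a)                   = A⊆U a
    go (reflexivity x)           = U.reflexivity x
    go (symmetry x y ε)          = U.symmetry x y ε
    go (triangle x y z ε ε′)     = U.triangle x y z ε ε′
    go (weakening x y ε ε′ 0<ε′) = U.weakening x y ε ε′ 0<ε′
    go (nonExpansivity f x y ε)  = U.nonExpansivity f x y ε
    go (continuity Γ t s ε h)    = U.continuity Γ t s ε λ ε′ ε<ε′ → go (h ε′ ε<ε′)
    go (substitution Γ φ σ h)    = U.substitution Γ φ σ (go h)
    go (assumption Γ φ φ∈Γ)      = U.assumption Γ φ φ∈Γ
    go (cut Γ Θ ψ h k)           = U.cut Γ Θ ψ (λ φ φ∈Θ → go (h φ φ∈Θ)) (go k)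

record QuantitativeAlgebra (S : Signature ℓ) : Set (suc ℓ) where
  field
    space     : ExtMetricSpace ℓ
    operation : ∀ f → NonExpansive (space ^ arity S f) space

  open ExtMetricSpace space public

  ⟦_⟧ : ∀ {v} {X : Set v} → Term S X → (X → Carrier space) → Carrier space
  ⟦ t ⟧ ι = foldTerm (λ f → fun (operation f)) ι t

  infix 4 _⊨_
  _⊨_ : (V → Carrier space) → QEquation S → Set ℓ
  ι ⊨ (t =⟨ ε ⟩ s) = d space (⟦ t ⟧ ι) (⟦ s ⟧ ι) ≤ℚ ε

  Satisfies : CQEquation S → Set ℓ
  Satisfies (Γ ⊢ φ) = ∀ ι → (∀ ψ → ψ ∈ Γ → ι ⊨ ψ) → ι ⊨ φ

record Model (S : Signature ℓ) (U : Theory S) : Set (suc ℓ) where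
  field
    algebra   : QuantitativeAlgebra S
    satisfies : ∀ φ → Member U φ → QuantitativeAlgebra.Satisfies algebra φ

  open QuantitativeAlgebra algebra public

record Homomorphism {S : Signature ℓ} (A B : QuantitativeAlgebra S) : Set ℓ where
  private
    module A = QuantitativeAlgebra A
    module B = QuantitativeAlgebra B
  field
    map′     : NonExpansive A.space B.space
    preserve : ∀ f (xs : Vector (Carrier A.space) (arity S f)) →
               fun map′ (fun (A.operation f) xs) B.≈ fun (B.operation f) λ i → fun map′ (xs i)

open Homomorphism

𝕂 : (S : Signature ℓ) (U : Theory S) → Category (suc ℓ) ℓ ℓ
𝕂 {ℓ} S U = record
  { Obj    = Model S U
  ; _⇒_    = λ A B → Homomorphism (Model.algebra A) (Model.algebra B)
  ; _≈_    = λ f g → M._≈_ (map′ f) (map′ g)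
  ; id     = λ {A} → record { map′ = idN ; preserve = λ f xs → Model.≈-refl A }
  ; _∘_    = λ {A} {B} {E} g f → record
    { map′     = map′ g ∘N map′ f
    ; preserve = λ o xs → Model.≈-trans E (fun-cong (map′ g) (preserve f o xs))
                            (preserve g o λ i → fun (map′ f) (xs i))
    }
  ; equiv  = λ {A} {B} → let open Model B in record
    { refl  = λ _ → ≈-refl
    ; sym   = λ p x → ≈-sym (p x)
    ; trans = λ p q x → ≈-trans (p x) (q x)
    }
  ; ∘-resp = λ {A} {B} {E} {f} {f′} {g} {g′} p q x →
      Model.≈-trans E (fun-cong (map′ f) (q x)) (p (fun (map′ g′) x))
  ; assoc  = λ {_} {_} {_} {W} _ → Model.≈-refl W
  ; idˡ    = λ {_} {Y} _ → Model.≈-refl Y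
  ; idʳ    = λ {_} {Y} _ → Model.≈-refl Y
  }
  where module M = Category (Met ℓ)

forget : (S : Signature ℓ) (U : Theory S) → Functor (𝕂 S U) (Met ℓ)
forget S U = record
  { F₀ = Model.space ; F₁ = map′ ; F-resp = λ p → p
  ; F-id = λ {A} _ → Model.≈-refl A ; F-∘ = λ {_} {_} {E} _ → Model.≈-refl E }

module Free (S : Signature ℓ) (U : Theory S) where

  -- Provable distances between terms over a metric space X: the least
  -- family closed under the rules of quantitative logic, the distances
  -- of X, and all substitution instances of members of U.
  infix 4 _∋_≈[_]_
  data _∋_≈[_]_ (X : ExtMetricSpace ℓ) : Term S (Carrier X) → ℚ≥0 → Term S (Carrier X) → Set ℓ where
    gen    : ∀ {x y} ε → d X x y ≤ℚ ε → X ∋ var x ≈[ ε ] var y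
    rfl    : ∀ {t} → X ∋ t ≈[ 0ᵠ ] t
    symm   : ∀ {t s ε} → X ∋ t ≈[ ε ] s → X ∋ s ≈[ ε ] t
    tri    : ∀ {t s r ε ε′} → X ∋ t ≈[ ε ] s → X ∋ s ≈[ ε′ ] r → X ∋ t ≈[ ε +ᵠ ε′ ] r
    weak   : ∀ {t s} ε ε′ → ε ≤ᵠ ε′ → X ∋ t ≈[ ε ] s → X ∋ t ≈[ ε′ ] s
    cont   : ∀ {t s} ε → (∀ ε′ → ε <ᵠ ε′ → X ∋ t ≈[ ε′ ] s) → X ∋ t ≈[ ε ] s
    congr  : ∀ f {ts ss ε} → (∀ i → X ∋ ts i ≈[ ε ] ss i) → X ∋ op f ts ≈[ ε ] op f ss
    member : ∀ {Γ t s ε} (σ : V → Term S (Carrier X)) → Member U (Γ ⊢ t =⟨ ε ⟩ s) →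
             (∀ ψ → ψ ∈ Γ →
               X ∋ QEquation.lhs ψ [ σ ]ᵗ ≈[ QEquation.ε ψ ] QEquation.rhs ψ [ σ ]ᵗ) →
             X ∋ t [ σ ]ᵗ ≈[ ε ] s [ σ ]ᵗ

  termSpace : ExtMetricSpace ℓ → ExtMetricSpace ℓ
  termSpace X = record
    { Carrier       = Term S (Carrier X)
    ; _≈_           = λ t s → X ∋ t ≈[ 0ᵠ ] s
    ; isEquivalence = record { refl = rfl ; sym = symm ; trans = λ h k → weak (0ᵠ +ᵠ 0ᵠ) 0ᵠ ℚ.≤-refl (tri h k) }
    ; d             = dᵗ
    ; d≃0⇒≈         = λ {t} {s} → ≃0⇒≤0 (dᵗ t s)
    ; ≈⇒d≃0         = λ {t} {s} → ≤0⇒≃0 (dᵗ t s)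
    ; d-sym         = λ _ _ → (λ _ → symm) , (λ _ → symm)
    ; d-triangle    = λ t s r → +-elim (dᵗ t s) (dᵗ s r) (dᵗ t r) λ _ _ → tri
    }
    where
    dᵗ : Term S (Carrier X) → Term S (Carrier X) → [0,∞] ℓ
    dᵗ t s = record { bound = λ ε → X ∋ t ≈[ ε ] s ; upper = weak ; closed = cont }

  freeModel : ExtMetricSpace ℓ → Model S U
  freeModel X = record
    { algebra   = record
      { space     = termSpace X
      ; operation = λ f → record { fun = op f ; nonExpansive = λ _ _ _ → congr f }
      }
    ; satisfies = λ _ φ∈U ι Γ-holds → member ι φ∈U Γ-holds
    }

  module _ {X : ExtMetricSpace ℓ} (A : Model S U) (g : NonExpansive X (Model.space A)) where
    private
      module A = Model A
      module X = ExtMetricSpace X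

    ⟦_⟧g : Term S X.Carrier → A.Carrier
    ⟦ t ⟧g = A.⟦ t ⟧ (fun g)

    ⟦⟧-subst : ∀ (σ : V → Term S X.Carrier) t → A.⟦ t ⟧ (λ v → ⟦ σ v ⟧g) A.≈ ⟦ t [ σ ]ᵗ ⟧g
    ⟦⟧-subst σ (var v)   = A.≈-refl
    ⟦⟧-subst σ (op f ts) = fun-cong (A.operation f) λ i → ⟦⟧-subst σ (ts i)

    ⟦⟧-nonExpansive : ∀ {t s ε} → X ∋ t ≈[ ε ] s → A.d ⟦ t ⟧g ⟦ s ⟧g ≤ℚ ε
    ⟦⟧-nonExpansive (gen {x} {y} ε h)  = nonExpansive g x y ε h
    ⟦⟧-nonExpansive rfl                = A.≈⇒≤0 A.≈-refl
    ⟦⟧-nonExpansive (symm {t} {s} {ε} h) =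
      proj₁ (A.d-sym ⟦ s ⟧g ⟦ t ⟧g) ε (⟦⟧-nonExpansive h)
    ⟦⟧-nonExpansive (tri {t} {s} {r} {ε} {ε′} h k) =
      A.d-triangle-ℚ ⟦ t ⟧g ⟦ s ⟧g ⟦ r ⟧g ε ε′ (⟦⟧-nonExpansive h) (⟦⟧-nonExpansive k)
    ⟦⟧-nonExpansive (weak {t} {s} ε ε′ ε≤ε′ h) =
      upper (A.d ⟦ t ⟧g ⟦ s ⟧g) ε ε′ ε≤ε′ (⟦⟧-nonExpansive h)
    ⟦⟧-nonExpansive (cont {t} {s} ε h) =
      closed (A.d ⟦ t ⟧g ⟦ s ⟧g) ε λ ε′ ε<ε′ → ⟦⟧-nonExpansive (h ε′ ε<ε′)
    ⟦⟧-nonExpansive (congr f {ts} {ss} {ε} h) =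
      nonExpansive (A.operation f) (λ i → ⟦ ts i ⟧g) (λ i → ⟦ ss i ⟧g) ε
        λ i → ⟦⟧-nonExpansive (h i)
    ⟦⟧-nonExpansive (member {Γ} {t} {s} {ε} σ φ∈U h) =
      A.d-resp (A.≈-sym (⟦⟧-subst σ t)) (A.≈-sym (⟦⟧-subst σ s)) ε
        (A.satisfies (Γ ⊢ t =⟨ ε ⟩ s) φ∈U (λ v → ⟦ σ v ⟧g) λ ψ ψ∈Γ →
          A.d-resp (⟦⟧-subst σ (QEquation.lhs ψ)) (⟦⟧-subst σ (QEquation.rhs ψ)) (QEquation.ε ψ)
            (⟦⟧-nonExpansive (h ψ ψ∈Γ)))

    extend : Homomorphism (Model.algebra (freeModel X)) A.algebra
    extend = record
      { map′     = record { fun = ⟦_⟧g ; nonExpansive = λ _ _ _ → ⟦⟧-nonExpansive }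
      ; preserve = λ _ _ → A.≈-refl
      }

  extend-unique : ∀ {X} (A : Model S U) (k l : Homomorphism (Model.algebra (freeModel X)) (Model.algebra A)) →
                  (∀ x → Model._≈_ A (fun (map′ k) (var x)) (fun (map′ l) (var x))) →
                  ∀ t → Model._≈_ A (fun (map′ k) t) (fun (map′ l) t)
  extend-unique A k l p (var x)   = p x
  extend-unique A k l p (op f ts) = Model.≈-trans A (preserve k f ts)
    (Model.≈-trans A (fun-cong (Model.operation A f) λ i → extend-unique A k l p (ts i))
      (Model.≈-sym A (preserve l f ts)))

  insert : ∀ X → NonExpansive X (termSpace X)
  insert X = record { fun = var ; nonExpansive = λ _ _ → gen }

  private
    module K = Category (𝕂 S U)

  free : Functor (Met ℓ) (𝕂 S U)
  free = record
    { F₀     = freeModel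
    ; F₁     = F
    ; F-resp = λ {X} {Y} {f} {g} p → extend-unique (freeModel Y) (F f) (F g)
                 λ x → gen 0ᵠ (ExtMetricSpace.≈⇒≤0 Y (p x))
    ; F-id   = λ {X} → extend-unique (freeModel X) (F idN) (K.id {freeModel X}) λ _ → rfl
    ; F-∘    = λ {X} {Y} {Z} {f} {g} → extend-unique (freeModel Z)
                 (F (f ∘N g)) (K._∘_ {freeModel X} {freeModel Y} {freeModel Z} (F f) (F g)) λ _ → rfl
    }
    where
    F : ∀ {X Y} → NonExpansive X Y → freeModel X K.⇒ freeModel Y
    F {X} {Y} f = extend (freeModel Y) (insert Y ∘N f)

  free⊣forget : free ⊣ forget S U
  free⊣forget = record
    { unit   = record { at = insert ; natural = λ _ _ → rfl }
    ; counit = record { at = counit ; natural = λ {A} {B} k →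
        extend-unique B
          (K._∘_ {FU A} {FU B} {B} (counit B) (F₁ free (map′ k)))
          (K._∘_ {FU A} {A} {B} k (counit A))
          λ _ → Model.≈-refl B }
    ; zig    = λ {X} → extend-unique (freeModel X)
        (K._∘_ {freeModel X} {freeModel (termSpace X)} {freeModel X}
          (counit (freeModel X)) (F₁ free (insert X)))
        (K.id {freeModel X}) λ _ → rfl
    ; zag    = λ {A} _ → Model.≈-refl A
    }
    where
    FU : Model S U → Model S U
    FU A = freeModel (Model.space A)

    counit : ∀ A → freeModel (Model.space A) K.⇒ A
    counit A = extend A idN

T[_] : {S : Signature ℓ} (U : Theory S) → Monad (Met ℓ)
T[_] {S = S} U = inducedMonad (Free.free⊣forget S U)

record MetricMonoid ℓ : Set (suc ℓ) where
  infixl 7 _*_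
  field
    space          : ExtMetricSpace ℓ
  private
    module Λ = ExtMetricSpace space
  field
    _*_            : Λ.Carrier → Λ.Carrier → Λ.Carrier
    0#             : Λ.Carrier
    isMonoid       : IsMonoid Λ._≈_ _*_ 0#
    *-nonExpansive : ∀ α β α′ β′ → Λ.d (α * β) (α′ * β′) ≤ Λ.d α α′ + Λ.d β β′

  open Λ public
  open IsMonoid isMonoid public using (assoc; identityˡ; identityʳ)

module _ (Λ : MetricMonoid ℓ) where
  private
    module Λ = MetricMonoid Λ
    open Λ using (_*_; 0#)

  writerSignature : Signature ℓ
  writerSignature = record { Symbol = Λ.Carrier ; arity = λ _ → 1 }

  w : Λ.Carrier → Term writerSignature V → Term writerSignature V
  w α t = op α λ _ → t

  data WriterAxiom : CQEquation writerSignature → Set ℓ where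
    w-zero : ∀ x → WriterAxiom ([] ⊢ var x =⟨ 0ᵠ ⟩ w 0# (var x))
    w-mult : ∀ α α′ x → WriterAxiom ([] ⊢ w α (w α′ (var x)) =⟨ 0ᵠ ⟩ w (α * α′) (var x))
    w-diff : ∀ α α′ x x′ ε δ → Λ.d α α′ + ⌜ ε ⌝ ≤ ⌜ δ ⌝ →
             WriterAxiom ([ var x =⟨ ε ⟩ var x′ ] ⊢ w α (var x) =⟨ δ ⟩ w α′ (var x′))

  writerTheory : Theory writerSignature
  writerTheory = theoryOf WriterAxiom

  writerFunctor : Functor (Met ℓ) (Met ℓ)
  writerFunctor = record
    { F₀     = Λ.space □_
    ; F₁     = λ {X} {Y} f → record
      { fun          = λ (α , x) → α , fun f x
      ; nonExpansive = λ (α , x) (β , y) →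
          +-mono (Λ.d α β) (Λ.d α β) (d Y (fun f x) (fun f y)) (d X x y)
            (λ _ h → h) (nonExpansive f x y)
      }
    ; F-resp = λ p (α , x) → Λ.≈-refl , p x
    ; F-id   = λ {X} _ → Λ.≈-refl , ExtMetricSpace.≈-refl X
    ; F-∘    = λ {_} {_} {Z} _ → Λ.≈-refl , ExtMetricSpace.≈-refl Z
    }

  writerUnit : ∀ X → NonExpansive X (Λ.space □ X)
  writerUnit X = record
    { fun          = λ x → 0# , x
    ; nonExpansive = λ x y q h →
        ≤ℚ-resp (Λ.d 0# 0# + d X x y) (0ᵠ +ᵠ q) q (ℚ.+-identityˡ (value q))
          (+-intro (Λ.d 0# 0#) (d X x y) 0ᵠ q (Λ.≈⇒≤0 Λ.≈-refl) h)
    }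

  writerMult : ∀ X → NonExpansive (Λ.space □ (Λ.space □ X)) (Λ.space □ X)
  writerMult X = record
    { fun          = λ (α , (α′ , x)) → α * α′ , x
    ; nonExpansive = λ (α , (α′ , x)) (β , (β′ , y)) q h →
        +-mono (Λ.d (α * α′) (β * β′)) (Λ.d α β + Λ.d α′ β′) (d X x y) (d X x y)
          (Λ.*-nonExpansive α α′ β β′) (λ _ k → k) q
          (+-assoc-≤ (Λ.d α β) (Λ.d α′ β′) (d X x y) q h)
    }

  writerη : NatTrans (idF (Met ℓ)) writerFunctor
  writerη = record
    { at = writerUnit ; natural = λ {_} {Y} _ _ → Λ.≈-refl , ExtMetricSpace.≈-refl Y }

  writerμ : NatTrans (writerFunctor ∘F writerFunctor) writerFunctor
  writerμ = record
    { at = writerMult ; natural = λ {_} {Y} _ _ → Λ.≈-refl , ExtMetricSpace.≈-refl Y }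

  writerMonad : Monad (Met ℓ)
  writerMonad = record
    { T       = writerFunctor
    ; η       = writerη
    ; μ       = writerμ
    ; μ-assoc = λ {X} (α , (β , (γ , x))) →
                  Λ.≈-sym (Λ.assoc α β γ) , ExtMetricSpace.≈-refl X
    ; μ-unitˡ = λ {X} (α , x) → Λ.identityˡ α , ExtMetricSpace.≈-refl X
    ; μ-unitʳ = λ {X} (α , x) → Λ.identityʳ α , ExtMetricSpace.≈-refl X
    }

{-# OPTIONS --safe #-}

-- Λ □ X is a model of the writer theory with w_α (β , x) = (α * β , x): the
-- last axiom is exactly non-expansiveness of * combined with the definition of
-- the sum metric.  The homomorphism T X → Λ □ X extending x ↦ (0 , x) has the
-- inverse (α , x) ↦ w_α x, because the first two axioms collapse every term to
-- a single symbol applied to a variable, and the third axiom makes this inverse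
-- non-expansive.
module Submission where

open import Level using (Level)
open import Data.Fin.Base using (zero)
import Data.Nat.Base as ℕ
open import Data.List.Relation.Unary.Any using (here; there)
open import Data.List.Membership.Propositional using (_∈_)
open import Data.List.Membership.Propositional.Properties using (∈-map⁺; ∈-tabulate⁺)
open import Data.Product.Base using (_,_; proj₁; proj₂)
import Data.Rational.Properties as ℚ
open import Algebra.Structures using (IsMonoid)
open import Relation.Binary.PropositionalEquality using (refl)
open import Defs

open NonExpansive
open Homomorphism

private
  variable
    ℓ : Level

module _ {S : Signature ℓ} (A : QuantitativeAlgebra S) where
  private
    module A = QuantitativeAlgebra A

  ⟦⟧-substitution : ∀ (ι : V → A.Carrier) (σ : V → Term S V) t →
                    A.⟦ t ⟧ (λ v → A.⟦ σ v ⟧ ι) A.≈ A.⟦ t [ σ ]ᵗ ⟧ ι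
  ⟦⟧-substitution ι σ (var v)   = A.≈-refl
  ⟦⟧-substitution ι σ (op f ts) = fun-cong (A.operation f) λ i → ⟦⟧-substitution ι σ (ts i)

  -- Soundness: with `theoryOf-least`, it reduces being a model of an axiomatized theory to checking
  -- the axioms alone.
  Satisfies-isTheory : IsTheory S A.Satisfies
  Satisfies-isTheory = record
    { reflexivity    = λ x ι _ → A.≈⇒≤0 A.≈-refl
    ; symmetry       = λ x y ε ι h → proj₁ (A.d-sym (ι y) (ι x)) ε (h _ (here refl))
    ; triangle       = λ x y z ε ε′ ι h →
        A.d-triangle-ℚ (ι x) (ι z) (ι y) ε ε′ (h _ (here refl)) (h _ (there (here refl)))
    ; weakening      = λ x y ε ε′ _ ι h →
        [0,∞].upper (A.d (ι x) (ι y)) ε (ε +ᵠ ε′) (≤ᵠ+ˡ ε ε′) (h _ (here refl))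
    ; nonExpansivity = λ f x y ε ι h →
        nonExpansive (A.operation f) (λ i → ι (x i)) (λ i → ι (y i)) ε λ i →
          h _ (∈-tabulate⁺ {f = λ i → var (x i) =⟨ ε ⟩ var (y i)} i)
    ; continuity     = λ Γ t s ε h ι k →
        [0,∞].closed (A.d (A.⟦ t ⟧ ι) (A.⟦ s ⟧ ι)) ε λ ε′ ε<ε′ → h ε′ ε<ε′ ι k
    ; substitution   = λ Γ φ σ h ι k →
        A.d-resp (A.≈-sym (⟦⟧-substitution ι σ (QEquation.lhs φ)))
                 (A.≈-sym (⟦⟧-substitution ι σ (QEquation.rhs φ))) (QEquation.ε φ)
          (h (λ v → A.⟦ σ v ⟧ ι) λ ψ ψ∈Γ →
            A.d-resp (⟦⟧-substitution ι σ (QEquation.lhs ψ))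
                     (⟦⟧-substitution ι σ (QEquation.rhs ψ)) (QEquation.ε ψ)
              (k (ψ [ σ ]ᵉ) (∈-map⁺ _[ σ ]ᵉ ψ∈Γ)))
    ; assumption     = λ Γ φ φ∈Γ ι h → h φ φ∈Γ
    ; cut            = λ Γ Θ ψ h k ι p → k ι λ φ φ∈Θ → h φ φ∈Θ ι p
    }

module _ (Λ : MetricMonoid ℓ) where
  private
    module Λ = MetricMonoid Λ
    open Λ using (_*_; 0#)
    S = writerSignature Λ
    U = writerTheory Λ
    module M = Category (Met ℓ)
    open Free S U using (_∋_≈[_]_; termSpace; extend; gen; rfl; symm; weak; cont; congr; member)

  *-cong : ∀ {α α′ β β′} → α Λ.≈ α′ → β Λ.≈ β′ → α * β Λ.≈ α′ * β′
  *-cong = IsMonoid.∙-cong Λ.isMonoid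

  module _ (X : ExtMetricSpace ℓ) where
    private
      module X = ExtMetricSpace X
      module P = ExtMetricSpace (Λ.space □ X)

    -- Non-expansiveness of `*` bounds the first coordinate, and reassociating the sum isolates the
    -- distance in `Λ.space □ X`. Taking `α′ = α` makes each operation non-expansive; the general
    -- case yields the third axiom.
    act-≤ : ∀ α α′ (a a′ : P.Carrier) →
            P.d (α * proj₁ a , proj₂ a) (α′ * proj₁ a′ , proj₂ a′) ≤ Λ.d α α′ + P.d a a′
    act-≤ α α′ (β , x) (β′ , x′) q h =
      +-mono (Λ.d (α * β) (α′ * β′)) (Λ.d α α′ + Λ.d β β′) (X.d x x′) (X.d x x′)
        (Λ.*-nonExpansive α β α′ β′) (λ _ k → k) q
        (+-assoc-≤ (Λ.d α α′) (Λ.d β β′) (X.d x x′) q h)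

    writerAlgebra : QuantitativeAlgebra S
    writerAlgebra = record
      { space     = Λ.space □ X
      ; operation = λ α → record
        { fun          = λ a → α * proj₁ (a zero) , proj₂ (a zero)
        ; nonExpansive = λ a a′ q h →
            let b = a zero ; b′ = a′ zero in
            ≤ℚ-resp (P.d (α * proj₁ b , proj₂ b) (α * proj₁ b′ , proj₂ b′)) (0ᵠ +ᵠ q) q
              (ℚ.+-identityˡ (value q))
              (act-≤ α α b b′ (0ᵠ +ᵠ q)
                (+-intro (Λ.d α α) (P.d b b′) 0ᵠ q (Λ.≈⇒≤0 Λ.≈-refl) (h zero)))
        }
      }

    writerAlgebra-axioms : ∀ {φ} → WriterAxiom Λ φ → QuantitativeAlgebra.Satisfies writerAlgebra φ
    writerAlgebra-axioms (w-zero x) ι _ =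
      P.≈⇒≤0 (Λ.≈-sym (Λ.identityˡ (proj₁ (ι x))) , X.≈-refl)
    writerAlgebra-axioms (w-mult α α′ x) ι _ =
      P.≈⇒≤0 (Λ.≈-sym (Λ.assoc α α′ (proj₁ (ι x))) , X.≈-refl)
    writerAlgebra-axioms (w-diff α α′ x x′ ε δ h) ι k =
      act-≤ α α′ (ι x) (ι x′) δ
        (+-mono (Λ.d α α′) (Λ.d α α′) (P.d (ι x) (ι x′)) ⌜ ε ⌝ (λ _ r → r)
          -- The premise bounds the distance of the arguments by `ε`, so the side condition on `δ`,
          -- read at `δ` itself, applies.
          (λ q (Level.lift ε≤q) → [0,∞].upper (P.d (ι x) (ι x′)) ε q ε≤q (k _ (here refl)))
          δ (h δ (Level.lift ℚ.≤-refl)))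

    writerModel : Model S U
    writerModel = record
      { algebra   = writerAlgebra
      ; satisfies = λ _ → theoryOf-least (WriterAxiom Λ) _ (Satisfies-isTheory writerAlgebra)
                            writerAlgebra-axioms
      }

    evaluate : NonExpansive (termSpace X) (Λ.space □ X)
    evaluate = map′ (extend writerModel (writerUnit Λ X))

    w-zero-≈ : ∀ t → X ∋ t ≈[ 0ᵠ ] op 0# (λ _ → t)
    w-zero-≈ t = member (λ _ → t) (axm (w-zero 0)) λ _ ()

    w-mult-≈ : ∀ α β t → X ∋ op α (λ _ → op β (λ _ → t)) ≈[ 0ᵠ ] op (α * β) (λ _ → t)
    w-mult-≈ α β t = member (λ _ → t) (axm (w-mult α β 0)) λ _ ()

    w-diff-≈ : ∀ {α α′ t t′ u v} → Λ.d α α′ ≤ℚ u → X ∋ t ≈[ v ] t′ →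
               X ∋ op α (λ _ → t) ≈[ u +ᵠ v ] op α′ (λ _ → t′)
    w-diff-≈ {α} {α′} {t} {t′} {u} {v} α≈α′ t≈t′ =
      member σ (axm (w-diff α α′ 0 1 v (u +ᵠ v) bound)) λ { _ (here refl) → t≈t′ }
      where
      σ : V → Term S X.Carrier
      -- Only variables 0 and 1 occur in the axiom instance; the value at all others is arbitrary.
      σ ℕ.zero    = t
      σ (ℕ.suc _) = t′

      bound : Λ.d α α′ + ⌜ v ⌝ ≤ ⌜ u +ᵠ v ⌝
      bound q (Level.lift u+v≤q) = [0,∞].upper (Λ.d α α′ + ⌜ v ⌝) (u +ᵠ v) q u+v≤q
        (+-intro (Λ.d α α′) ⌜ v ⌝ u v α≈α′ (Level.lift ℚ.≤-refl))

    write : NonExpansive (Λ.space □ X) (termSpace X)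
    write = record
      { fun          = λ (α , x) → op α λ _ → var x
      -- A bound `q` on a sum splits into rational bounds `u`, `v` only below each `p` greater than
      -- `q`, so the continuity rule is needed to reach `q`.
      ; nonExpansive = λ _ _ q h → cont q λ p q<p →
          let (u , v , α≤u , x≤v , u+v≤p) = h p q<p
          in weak (u +ᵠ v) p u+v≤p (w-diff-≈ α≤u (gen v x≤v))
      }

    evaluate∘write : evaluate ∘N write M.≈ idN
    evaluate∘write (α , x) = Λ.identityʳ α , X.≈-refl

    -- Induction on terms: the argument of a symbol is provably equal to one symbol on a variable,
    -- and `w-mult-≈` fuses the two symbols. A bare variable acquires `0#` by the first axiom.
    write∘evaluate : write ∘N evaluate M.≈ idN
    write∘evaluate (var x)   = symm (w-zero-≈ (var x))
    write∘evaluate (op α ts) = T.≈-trans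
      (symm (w-mult-≈ α (proj₁ a) (var (proj₂ a))))
      (congr α λ { zero → write∘evaluate (ts zero) })
      where
      module T = ExtMetricSpace (termSpace X)
      a = fun evaluate (ts zero)

  open Monad using (T; μ)
  open Functor using (F₁)
  open NatTrans using (at)

  evaluate-natural : ∀ {X Y} (f : NonExpansive X Y) →
    evaluate Y ∘N F₁ (T T[ U ]) f M.≈ F₁ (writerFunctor Λ) f ∘N evaluate X
  evaluate-natural {Y = Y} f (var x)   = Λ.≈-refl , ExtMetricSpace.≈-refl Y
  evaluate-natural         f (op α ts) =
    let (p , q) = evaluate-natural f (ts zero) in *-cong Λ.≈-refl p , q

  -- The multiplication of `T[ U ]` flattens a term whose variables are terms. Induction on the
  -- outer term uses the left unit law at a variable and associativity at a symbol.
  evaluate-μ : ∀ X → evaluate X ∘N at (μ T[ U ]) X M.≈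
    writerMult Λ X ∘N F₁ (writerFunctor Λ) (evaluate X) ∘N evaluate (termSpace X)
  evaluate-μ X (var t)   = Λ.≈-sym (Λ.identityˡ _) , ExtMetricSpace.≈-refl X
  evaluate-μ X (op α ts) =
    let (p , q) = evaluate-μ X (ts zero)
    in Λ.≈-trans (*-cong Λ.≈-refl p) (Λ.≈-sym (Λ.assoc α _ _)) , q

  evaluateMorphism : MonadMorphism T[ U ] (writerMonad Λ)
  evaluateMorphism = record
    { transf     = record { at = evaluate ; natural = evaluate-natural }
    ; preserve-η = λ {X} _ → Λ.≈-refl , ExtMetricSpace.≈-refl X
    ; preserve-μ = λ {X} → evaluate-μ X
    }

  -- Relabelling variables commutes with `write` by computation; the unit and multiplication laws
  -- are instances of the first two axioms.
  writeMorphism : MonadMorphism (writerMonad Λ) T[ U ]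
  writeMorphism = record
    { transf     = record { at = write ; natural = λ _ _ → rfl }
    ; preserve-η = λ {X} x → symm (w-zero-≈ X (var x))
    ; preserve-μ = λ {X} (α , (β , x)) → symm (w-mult-≈ X α β (var x))
    }

theorem4p10 : ∀ {ℓ : Level} (Λ : MetricMonoid ℓ) →
    T[ writerTheory Λ ] ≅ writerMonad Λ
theorem4p10 Λ = record
  { to      = evaluateMorphism Λ
  ; from    = writeMorphism Λ
  ; to∘from = λ {X} → evaluate∘write Λ X
  ; from∘to = λ {X} → write∘evaluate Λ X
  }
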